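{- Let $f\colon\{0,1\}^n\to\{0,1\}$ be a Boolean function and let $A,B$ be sets with $f^{ -1}(1)\subseteq A\subseteq\tilde f^{ -1}(1)$ and $f^{ -1}(0)\subseteq B\subseteq\tilde f^{ -1}(0)$. Then the hazard-free Karchmer–Wigderson game in which Alice gets an input from $A$ and Bob gets an input from $B$ characterizes De Morgan formulas computing $f$ that are hazard-free on the inputs in $A\uplus B$: the minimal depth of a De Morgan formula computing $f$ that is hazard-free on $A\uplus B$ equals the communication cost of this game, and the minimal size of such a formula equals the minimum number of leaves of a protocol solving this game.
   Context: **Three-valued logic.** Let $\mathsf u$ be a third symbol, thought of as $\tfrac12$, so $0<\mathsf u<1$; $x\wedge y=\min(x,y)$, $x\vee y=\max(x,y)$, $\neg x=1-x$ on $\{0,\mathsf u,1\}$. A resolution of $\alpha\in\{0,\mathsf u,1\}^n$ is a string $a\in\{0,1\}^n$ with $a_i=\alpha_i$ whenever $\alpha_i\ne\mathsf u$. The hazard-free extension $\tilde f\colon\{0,\mathsf u,1\}^n\to\{0,\mathsf u,1\}$ of $f$ is: $\tilde f(\alpha)=c\in\{0,1\}$ if $f(a)=c$ for all resolutions $a$ of $\alpha$, and $\tilde f(\alpha)=\mathsf u$ otherwise. **Formulas.** A De Morgan formula is a binary tree whose internal nodes are labeled $\vee$ or $\wedge$ (fan-in two) and whose leaves are labeled by literals $x_i$ or $\neg x_i$, evaluated on $\{0,\mathsf u,1\}^n$ by the rules above. Size is the number of leaves; depth is the length of the longest root-to-leaf path. A formula $F$ computing $f$ is hazard-free on the inputs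 in $A\uplus B$ (disjoint union) if $F(\gamma)=\tilde f(\gamma)$ for all $\gamma\in A\uplus B$. **The game on $A\times B$.** Alice gets $\alpha\in A$, Bob gets $\beta\in B$; valid answers are the $i\in[n]$ with $\alpha_i\ne\beta_i$, $\alpha_i\ne\mathsf u$, $\beta_i\ne\mathsf u$. Protocols are deterministic: a binary tree, each internal node owned by Alice or Bob, who sends one bit depending on their own input; each leaf carries an answer valid for all inputs reaching it. The communication cost of the game is the minimum over protocols solving it of the maximum number of bits exchanged.
   Formalization: f is assumed non-constant: for constant f (n ≥ 1) one of A, B is empty, so a one-leaf protocol of cost 0 solves the game, while any formula has size at least 2 and depth at least 1; membership in A and B is assumed decidable, which excluded middle supplies. -}

module Defs where

open import Level using (0ℓ)
open import Data.Bool using (Bool; true; false; if_then_else_)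
import Data.Bool.Properties as Bool
open import Data.Nat using (ℕ; zero; suc; _+_; _⊔_; _≤_)
open import Data.Fin using (Fin)
import Data.Fin.Properties as Fin
open import Data.Vec using (Vec; []; _∷_; lookup; map)
open import Data.Product using (∃-syntax; _×_; _,_)
open import Relation.Nullary using (Dec; yes; no; ¬?)
open import Relation.Nullary.Decidable using (map′; _×-dec_; _→-dec_)
open import Relation.Unary using (Pred; Decidable; _∈_; _∪_)
open import Relation.Binary.Definitions using (DecidableEquality)
open import Relation.Binary.PropositionalEquality using (_≡_; _≢_; refl)

private
  variable
    n : ℕ

------------------------------------------------------------------------
-- Three-valued logic

data Three : Set where
  𝟎 𝐮 𝟏 : Three

_≟_ : DecidableEquality Three
𝟎 ≟ 𝟎 = yes refl
𝟎 ≟ 𝐮 = no λ ()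
𝟎 ≟ 𝟏 = no λ ()
𝐮 ≟ 𝟎 = no λ ()
𝐮 ≟ 𝐮 = yes refl
𝐮 ≟ 𝟏 = no λ ()
𝟏 ≟ 𝟎 = no λ ()
𝟏 ≟ 𝐮 = no λ ()
𝟏 ≟ 𝟏 = yes refl

-- Minimum, maximum and x ↦ 1 - x for the order 𝟎 < 𝐮 < 𝟏.

_∧₃_ : Three → Three → Three
𝟎 ∧₃ _ = 𝟎
𝐮 ∧₃ 𝟎 = 𝟎
𝐮 ∧₃ 𝐮 = 𝐮
𝐮 ∧₃ 𝟏 = 𝐮
𝟏 ∧₃ y = y

_∨₃_ : Three → Three → Three
𝟎 ∨₃ y = y
𝐮 ∨₃ 𝟎 = 𝐮
𝐮 ∨₃ 𝐮 = 𝐮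
𝐮 ∨₃ 𝟏 = 𝟏
𝟏 ∨₃ _ = 𝟏

¬₃_ : Three → Three
¬₃ 𝟎 = 𝟏
¬₃ 𝐮 = 𝐮
¬₃ 𝟏 = 𝟎

fromBool : Bool → Three
fromBool false = 𝟎
fromBool true  = 𝟏

embed : Vec Bool n → Vec Three n
embed = map fromBool

------------------------------------------------------------------------
-- Hazard-free extension

_IsResolutionOf_ : Vec Bool n → Vec Three n → Set
a IsResolutionOf α =
  ∀ i → lookup α i ≢ 𝐮 → fromBool (lookup a i) ≡ lookup α i

ConstantOnResolutions : (Vec Bool n → Bool) → Vec Three n → Bool → Set
ConstantOnResolutions f α c = ∀ a → a IsResolutionOf α → f a ≡ c

isResolutionOf? : (a : Vec Bool n) (α : Vec Three n) → Dec (a IsResolutionOf α)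
isResolutionOf? a α =
  Fin.all? λ i → ¬? (lookup α i ≟ 𝐮) →-dec (fromBool (lookup a i) ≟ lookup α i)

allVec? : {P : Pred (Vec Bool n) 0ℓ} → Decidable P → Dec (∀ a → P a)
allVec? {zero}  P? = map′ (λ { p [] → p }) (λ p → p []) (P? [])
allVec? {suc n} P? =
  map′ (λ { (p , q) (false ∷ a) → p a ; (p , q) (true ∷ a) → q a })
       (λ p → (λ a → p (false ∷ a)) , (λ a → p (true ∷ a)))
       (allVec? (λ a → P? (false ∷ a)) ×-dec allVec? (λ a → P? (true ∷ a)))

constantOnResolutions? : (f : Vec Bool n → Bool) (α : Vec Three n) (c : Bool) →
                         Dec (ConstantOnResolutions f α c)
constantOnResolutions? f α c =
  allVec? λ a → isResolutionOf? a α →-dec (f a Bool.≟ c)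

-- Every α has a resolution, so the first two cases exclude each other and
-- the order in which they are tested is irrelevant.
hazardFreeExt : (Vec Bool n → Bool) → Vec Three n → Three
hazardFreeExt f α with constantOnResolutions? f α true
                     | constantOnResolutions? f α false
... | yes _ | _     = 𝟏
... | no _  | yes _ = 𝟎
... | no _  | no _  = 𝐮

------------------------------------------------------------------------
-- De Morgan formulas

data Formula (n : ℕ) : Set where
  pos neg    : Fin n → Formula n
  _and_ _or_ : Formula n → Formula n → Formula n

eval : Formula n → Vec Three n → Three
eval (pos i)   γ = lookup γ i
eval (neg i)   γ = ¬₃ lookup γ i
eval (F and G) γ = eval F γ ∧₃ eval G γ
eval (F or G)  γ = eval F γ ∨₃ eval G γ

size : Formula n → ℕ
size (pos _)   = 1
size (neg _)   = 1
size (F and G) = size F + size G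
size (F or G)  = size F + size G

depth : Formula n → ℕ
depth (pos _)   = 0
depth (neg _)   = 0
depth (F and G) = suc (depth F ⊔ depth G)
depth (F or G)  = suc (depth F ⊔ depth G)

Computes : Formula n → (Vec Bool n → Bool) → Set
Computes F f = ∀ a → eval F (embed a) ≡ fromBool (f a)

HazardFreeOn : Formula n → (Vec Bool n → Bool) → Pred (Vec Three n) 0ℓ → Set
HazardFreeOn F f C = ∀ γ → γ ∈ C → eval F γ ≡ hazardFreeExt f γ

------------------------------------------------------------------------
-- Communication protocols

-- Messages are functions on all of X and Y; a game on A × B constrains the
-- protocol only on inputs from A and B.
data Protocol (X Y Z : Set) : Set where
  leaf  : Z → Protocol X Y Z
  alice : (X → Bool) → (ifTrue ifFalse : Protocol X Y Z) → Protocol X Y Z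
  bob   : (Y → Bool) → (ifTrue ifFalse : Protocol X Y Z) → Protocol X Y Z

module _ {X Y Z : Set} where

  answer : Protocol X Y Z → X → Y → Z
  answer (leaf z)      x y = z
  answer (alice m p q) x y = if m x then answer p x y else answer q x y
  answer (bob m p q)   x y = if m y then answer p x y else answer q x y

  bits : Protocol X Y Z → X → Y → ℕ
  bits (leaf z)      x y = 0
  bits (alice m p q) x y = suc (if m x then bits p x y else bits q x y)
  bits (bob m p q)   x y = suc (if m y then bits p x y else bits q x y)

  leaves : Protocol X Y Z → ℕ
  leaves (leaf _)      = 1
  leaves (alice _ p q) = leaves p + leaves q
  leaves (bob _ p q)   = leaves p + leaves q

KWProtocol : ℕ → Set
KWProtocol n = Protocol (Vec Three n) (Vec Three n) (Fin n)

ValidAnswer : Vec Three n → Vec Three n → Fin n → Set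
ValidAnswer α β i =
  lookup α i ≢ lookup β i × lookup α i ≢ 𝐮 × lookup β i ≢ 𝐮

Solves : KWProtocol n → (A B : Pred (Vec Three n) 0ℓ) → Set
Solves p A B = ∀ {α β} → α ∈ A → β ∈ B → ValidAnswer α β (answer p α β)

------------------------------------------------------------------------
-- Complexity measures, as relations "the minimum is k"

IsMinimum : Pred ℕ 0ℓ → ℕ → Set
IsMinimum P k = P k × (∀ j → P j → k ≤ j)

IsMaximum : Pred ℕ 0ℓ → ℕ → Set
IsMaximum P k = P k × (∀ j → P j → j ≤ k)

module _ (f : Vec Bool n → Bool) (A B : Pred (Vec Three n) 0ℓ) where

  IsMinimalDepth : ℕ → Set
  IsMinimalDepth = IsMinimum λ d →
    ∃[ F ] Computes F f × HazardFreeOn F f (A ∪ B) × depth F ≡ d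

  IsMinimalSize : ℕ → Set
  IsMinimalSize = IsMinimum λ s →
    ∃[ F ] Computes F f × HazardFreeOn F f (A ∪ B) × size F ≡ s

module _ (A B : Pred (Vec Three n) 0ℓ) where

  -- The maximum is over actual input pairs from A × B, not over all
  -- root-to-leaf paths.
  IsCost : KWProtocol n → ℕ → Set
  IsCost p = IsMaximum λ b →
    ∃[ α ] ∃[ β ] α ∈ A × β ∈ B × bits p α β ≡ b

  IsCommunicationCost : ℕ → Set
  IsCommunicationCost = IsMinimum λ c → ∃[ p ] Solves p A B × IsCost p c

  IsMinimalLeaves : ℕ → Set
  IsMinimalLeaves = IsMinimum λ l → ∃[ p ] Solves p A B × leaves p ≡ l

{-# OPTIONS --safe #-}
-- A formula becomes a protocol when Alice resolves the or-gates and Bob the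
-- and-gates: a gate of value 𝟏 (at an or) or 𝟎 (at an and) has a child of the
-- same value, because min and max on the chain 𝟎 < 𝐮 < 𝟏 return one of their
-- arguments.  Conversely, a protocol solving a nonempty rectangle A × B becomes
-- a formula that is 𝟏 on A and 𝟎 on B; useless messages are pruned, since there
-- are no constant leaves to put in an empty subrectangle.
--
-- The minima are attained because there are finitely many formulas of bounded
-- depth, and some formula exists: α and β without a valid answer would have a
-- common resolution, on which f would be both true and false.
module Submission where

open import Level using (0ℓ)
open import Data.Bool using (Bool; true; false)
import Data.Bool.Properties as Bool
open import Data.Empty using (⊥-elim)
open import Data.Fin using (Fin)
import Data.Fin.Properties as Fin
open import Data.List using (List; []; _∷_; allFin)
open import Data.List.Membership.Propositional using (lose)
open import Data.List.Membership.Propositional.Properties using (∈-allFin)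
open import Data.List.Relation.Unary.Any using (Any; here; there)
open import Data.Nat using (ℕ; zero; suc; _+_; _⊔_; _≤_; z≤n; s≤s)
import Data.Nat.Properties as ℕ
open import Data.Product using (∃; ∃-syntax; _×_; _,_; proj₁; proj₂)
open import Data.Sum using (_⊎_; inj₁; inj₂)
open import Data.Vec using (Vec; []; _∷_; lookup; tabulate)
open import Data.Vec.Properties using (lookup∘tabulate)
open import Function using (_∘_)
open import Relation.Nullary using (¬_; Dec; yes; no; ¬?; does; contradiction)
open import Relation.Nullary.Decidable using (map′; _×-dec_; _⊎-dec_; _→-dec_; decidable-stable)
open import Relation.Unary using (Pred; Decidable; _∈_; _∩_; _∪_)
open import Relation.Unary.Properties using (_∩?_)
open import Relation.Binary.PropositionalEquality
  using (_≡_; _≢_; refl; sym; trans; cong; cong₂)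
open import Defs

private
  variable
    n : ℕ

-- Least witnesses and finite searches

leastNumber : {P : Pred ℕ 0ℓ} → Decidable P → ∀ k → P k → ∃ (IsMinimum P)
leastNumber P? zero    pk = 0 , pk , λ _ _ → z≤n
leastNumber P? (suc k) pk with P? 0
... | yes p0 = 0 , p0 , λ _ _ → z≤n
... | no ¬p0 with leastNumber (P? ∘ suc) k pk
...   | m , pm , m-least =
        suc m , pm , λ { zero p0 → ⊥-elim (¬p0 p0) ; (suc j) pj → s≤s (m-least j pj) }

any₃? : {P : Pred Three 0ℓ} → Decidable P → Dec (∃ P)
any₃? P? =
  map′ (λ { (inj₁ p) → 𝟎 , p ; (inj₂ (inj₁ p)) → 𝐮 , p ; (inj₂ (inj₂ p)) → 𝟏 , p })
       (λ { (𝟎 , p) → inj₁ p ; (𝐮 , p) → inj₂ (inj₁ p) ; (𝟏 , p) → inj₂ (inj₂ p) })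
       (P? 𝟎 ⊎-dec P? 𝐮 ⊎-dec P? 𝟏)

anyVec₃? : {P : Pred (Vec Three n) 0ℓ} → Decidable P → Dec (∃ P)
anyVec₃? {zero}  P? = map′ (λ p → [] , p) (λ { ([] , p) → p }) (P? [])
anyVec₃? {suc n} P? =
  map′ (λ { (x , γ , p) → x ∷ γ , p }) (λ { (x ∷ γ , p) → x , γ , p })
       (any₃? λ x → anyVec₃? λ γ → P? (x ∷ γ))

allVec₃? : {P : Pred (Vec Three n) 0ℓ} → Decidable P → Dec (∀ γ → P γ)
allVec₃? P? =
  map′ (λ ¬∃ γ → decidable-stable (P? γ) λ ¬p → ¬∃ (γ , ¬p))
       (λ { ∀p (γ , ¬p) → ¬p (∀p γ) })
       (¬? (anyVec₃? (¬? ∘ P?)))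

-- A gate takes two nested searches: the predicate tested on the left child is itself a search for
-- the right child. Keeping `Q` arbitrary in the recursion allows this.
anyOfDepth≤? : {Q : Pred (Formula n) 0ℓ} → Decidable Q → ∀ d →
               Dec (∃[ F ] depth F ≤ d × Q F)
anyOfDepth≤? Q? zero =
  map′ (λ { (inj₁ (i , q)) → pos i , z≤n , q ; (inj₂ (i , q)) → neg i , z≤n , q })
       (λ { (pos i , _ , q) → inj₁ (i , q) ; (neg i , _ , q) → inj₂ (i , q) })
       (Fin.any? (Q? ∘ pos) ⊎-dec Fin.any? (Q? ∘ neg))
anyOfDepth≤? Q? (suc d) =
  map′ (λ { (inj₁ (i , q)) → pos i , z≤n , q
          ; (inj₂ (inj₁ (i , q))) → neg i , z≤n , q
          ; (inj₂ (inj₂ (inj₁ (F , F≤d , G , G≤d , q)))) →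
              F and G , s≤s (ℕ.⊔-lub F≤d G≤d) , q
          ; (inj₂ (inj₂ (inj₂ (F , F≤d , G , G≤d , q)))) →
              F or G , s≤s (ℕ.⊔-lub F≤d G≤d) , q })
       (λ { (pos i , _ , q) → inj₁ (i , q)
          ; (neg i , _ , q) → inj₂ (inj₁ (i , q))
          ; (F and G , s≤s F⊔G≤d , q) → inj₂ (inj₂ (inj₁
              (F , ℕ.m⊔n≤o⇒m≤o _ _ F⊔G≤d , G , ℕ.m⊔n≤o⇒n≤o _ _ F⊔G≤d , q)))
          ; (F or G , s≤s F⊔G≤d , q) → inj₂ (inj₂ (inj₂
              (F , ℕ.m⊔n≤o⇒m≤o _ _ F⊔G≤d , G , ℕ.m⊔n≤o⇒n≤o _ _ F⊔G≤d , q))) })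
       (Fin.any? (Q? ∘ pos) ⊎-dec Fin.any? (Q? ∘ neg) ⊎-dec
        anyOfDepth≤? (λ F → anyOfDepth≤? (λ G → Q? (F and G)) d) d ⊎-dec
        anyOfDepth≤? (λ F → anyOfDepth≤? (λ G → Q? (F or G)) d) d)

⊔<+ : ∀ {a b k l} → suc a ≤ k → suc b ≤ l → suc (suc (a ⊔ b)) ≤ k + l
⊔<+ {a} {b} {k} {l} a<k b<l = begin
  suc (suc (a ⊔ b))      ≤⟨ s≤s (s≤s (ℕ.m⊔n≤m+n a b)) ⟩
  suc (suc (a + b))      ≡⟨ cong suc (ℕ.+-suc a b) ⟨
  suc a + suc b          ≤⟨ ℕ.+-mono-≤ a<k b<l ⟩
  k + l                  ∎
  where open ℕ.≤-Reasoning

-- A gate adds one level, while its shallower child adds at least one leaf. This bounds the depth of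
-- formulas of a given size, so a search through them is finite.
depth<size : (F : Formula n) → suc (depth F) ≤ size F
depth<size (pos _)   = ℕ.≤-refl
depth<size (neg _)   = ℕ.≤-refl
depth<size (F and G) = ⊔<+ (depth<size F) (depth<size G)
depth<size (F or G)  = ⊔<+ (depth<size F) (depth<size G)

-- Values of gates in three-valued logic

∧₃-𝟏ˡ : ∀ {x y} → x ∧₃ y ≡ 𝟏 → x ≡ 𝟏
∧₃-𝟏ˡ {𝐮} {𝟎} ()
∧₃-𝟏ˡ {𝐮} {𝐮} ()
∧₃-𝟏ˡ {𝐮} {𝟏} ()
∧₃-𝟏ˡ {𝟏} _ = refl

∧₃-𝟏ʳ : ∀ {x y} → x ∧₃ y ≡ 𝟏 → y ≡ 𝟏
∧₃-𝟏ʳ {𝐮} {𝟎} ()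
∧₃-𝟏ʳ {𝐮} {𝐮} ()
∧₃-𝟏ʳ {𝐮} {𝟏} ()
∧₃-𝟏ʳ {𝟏} e = e

-- Phrased with `x ≢ 𝟎` because a failed message test at an `and` gate provides exactly this.
∧₃-𝟎 : ∀ {x y} → x ∧₃ y ≡ 𝟎 → x ≢ 𝟎 → y ≡ 𝟎
∧₃-𝟎 {𝟎}     _ x≢𝟎 = contradiction refl x≢𝟎
∧₃-𝟎 {𝐮} {𝟎} _ _   = refl
∧₃-𝟎 {𝟏}     e _   = e

∨₃-𝟎ˡ : ∀ {x y} → x ∨₃ y ≡ 𝟎 → x ≡ 𝟎
∨₃-𝟎ˡ {𝟎} _ = refl
∨₃-𝟎ˡ {𝐮} {𝟎} ()
∨₃-𝟎ˡ {𝐮} {𝐮} ()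
∨₃-𝟎ˡ {𝐮} {𝟏} ()

∨₃-𝟎ʳ : ∀ {x y} → x ∨₃ y ≡ 𝟎 → y ≡ 𝟎
∨₃-𝟎ʳ {𝟎} e = e
∨₃-𝟎ʳ {𝐮} {𝟎} ()
∨₃-𝟎ʳ {𝐮} {𝐮} ()
∨₃-𝟎ʳ {𝐮} {𝟏} ()

∨₃-𝟏 : ∀ {x y} → x ∨₃ y ≡ 𝟏 → x ≢ 𝟏 → y ≡ 𝟏
∨₃-𝟏 {𝟎}     e _   = e
∨₃-𝟏 {𝐮} {𝟏} _ _   = refl
∨₃-𝟏 {𝟏}     _ x≢𝟏 = contradiction refl x≢𝟏

∨₃-zeroʳ : ∀ x → x ∨₃ 𝟏 ≡ 𝟏
∨₃-zeroʳ 𝟎 = refl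
∨₃-zeroʳ 𝐮 = refl
∨₃-zeroʳ 𝟏 = refl

∧₃-zeroʳ : ∀ x → x ∧₃ 𝟎 ≡ 𝟎
∧₃-zeroʳ 𝟎 = refl
∧₃-zeroʳ 𝐮 = refl
∧₃-zeroʳ 𝟏 = refl

¬₃-𝟏 : ∀ {x} → ¬₃ x ≡ 𝟏 → x ≡ 𝟎
¬₃-𝟏 {𝟎} _ = refl

¬₃-𝟎 : ∀ {x} → ¬₃ x ≡ 𝟎 → x ≡ 𝟏
¬₃-𝟎 {𝟏} _ = refl

-- From formulas to protocols

-- A variable and its negation give the same answer. Messages test exact equality with `𝟎` or `𝟏`,
-- so a left child of value `𝐮` leads to the right child.
toProtocol : Formula n → KWProtocol n
toProtocol (pos i)   = leaf i
toProtocol (neg i)   = leaf i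
toProtocol (F and G) = bob (λ β → does (eval F β ≟ 𝟎)) (toProtocol F) (toProtocol G)
toProtocol (F or G)  = alice (λ α → does (eval F α ≟ 𝟏)) (toProtocol F) (toProtocol G)

leaves-toProtocol : (F : Formula n) → leaves (toProtocol F) ≡ size F
leaves-toProtocol (pos _)   = refl
leaves-toProtocol (neg _)   = refl
leaves-toProtocol (F and G) = cong₂ _+_ (leaves-toProtocol F) (leaves-toProtocol G)
leaves-toProtocol (F or G)  = cong₂ _+_ (leaves-toProtocol F) (leaves-toProtocol G)

bits-toProtocol : (F : Formula n) → ∀ α β → bits (toProtocol F) α β ≤ depth F
bits-toProtocol (pos _) α β = z≤n
bits-toProtocol (neg _) α β = z≤n
bits-toProtocol (F and G) α β with eval F β ≟ 𝟎
... | yes _ = s≤s (ℕ.m≤n⇒m≤n⊔o _ (bits-toProtocol F α β))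
... | no  _ = s≤s (ℕ.m≤n⇒m≤o⊔n _ (bits-toProtocol G α β))
bits-toProtocol (F or G) α β with eval F α ≟ 𝟏
... | yes _ = s≤s (ℕ.m≤n⇒m≤n⊔o _ (bits-toProtocol F α β))
... | no  _ = s≤s (ℕ.m≤n⇒m≤o⊔n _ (bits-toProtocol G α β))

-- The invariant "`𝟏` at `α`, `𝟎` at `β`" passes to the chosen child: at an `and` gate both children
-- are `𝟏` at `α` and Bob picks one that is `𝟎` at `β`; dually at an `or` gate. At a literal it
-- makes the two coordinates opposite and stable.
answer-toProtocol : (F : Formula n) → ∀ {α β} → eval F α ≡ 𝟏 → eval F β ≡ 𝟎 →
                    ValidAnswer α β (answer (toProtocol F) α β)
answer-toProtocol (pos i) α≡𝟏 β≡𝟎 rewrite α≡𝟏 | β≡𝟎 = (λ ()) , (λ ()) , λ ()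
answer-toProtocol (neg i) ¬α≡𝟏 ¬β≡𝟎 rewrite ¬₃-𝟏 ¬α≡𝟏 | ¬₃-𝟎 ¬β≡𝟎 =
  (λ ()) , (λ ()) , λ ()
answer-toProtocol (F and G) {α} {β} α≡𝟏 β≡𝟎 with eval F β ≟ 𝟎
... | yes Fβ≡𝟎 = answer-toProtocol F (∧₃-𝟏ˡ α≡𝟏) Fβ≡𝟎
... | no  Fβ≢𝟎 = answer-toProtocol G (∧₃-𝟏ʳ {eval F α} α≡𝟏) (∧₃-𝟎 β≡𝟎 Fβ≢𝟎)
answer-toProtocol (F or G) {α} {β} α≡𝟏 β≡𝟎 with eval F α ≟ 𝟏
... | yes Fα≡𝟏 = answer-toProtocol F Fα≡𝟏 (∨₃-𝟎ˡ β≡𝟎)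
... | no  Fα≢𝟏 = answer-toProtocol G (∨₃-𝟏 α≡𝟏 Fα≢𝟏) (∨₃-𝟎ʳ {eval F β} β≡𝟎)

-- From protocols to formulas

-- This replaces hazard-freeness in the induction on protocols: it does not mention `f` and makes
-- sense for every subrectangle.
Separates : Formula n → (A B : Pred (Vec Three n) 0ℓ) → Set
Separates F A B = (∀ α → α ∈ A → eval F α ≡ 𝟏) × (∀ β → β ∈ B → eval F β ≡ 𝟎)

separates? : {A B : Pred (Vec Three n) 0ℓ} → Decidable A → Decidable B →
             (F : Formula n) → Dec (Separates F A B)
separates? A? B? F = allVec₃? (λ α → A? α →-dec (eval F α ≟ 𝟏)) ×-dec
                     allVec₃? (λ β → B? β →-dec (eval F β ≟ 𝟎))

-- The depth is bounded by the bits exchanged on an actual input pair, since the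
-- cost of a protocol ignores paths that no pair follows.
record Extracted (p : KWProtocol n) (A B : Pred (Vec Three n) 0ℓ) : Set where
  field
    formula   : Formula n
    separates : Separates formula A B
    size≤     : size formula ≤ leaves p
    {α β}     : Vec Three n
    α∈A       : α ∈ A
    β∈B       : β ∈ B
    depth≤    : depth formula ≤ bits p α β

open Extracted

Sends : {X : Set} → (X → Bool) → Bool → Pred X 0ℓ
Sends m b x = m x ≡ b

sends? : {X : Set} (m : X → Bool) (b : Bool) → Decidable (Sends m b)
sends? m b x = m x Bool.≟ b

-- Solves with explicit inputs, which unification cannot recover from an answer.
SolvesAll : KWProtocol n → (A B : Pred (Vec Three n) 0ℓ) → Set
SolvesAll p A B = ∀ α β → α ∈ A → β ∈ B → ValidAnswer α β (answer p α β)

module _ {A B : Pred (Vec Three n) 0ℓ} (m : Vec Three n → Bool) (p q : KWProtocol n) where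

  solves-aliceᵗ : SolvesAll (alice m p q) A B → SolvesAll p (A ∩ Sends m true) B
  solves-aliceᵗ s α β (a , e) b with s α β a b
  ... | v rewrite e = v

  solves-aliceᶠ : SolvesAll (alice m p q) A B → SolvesAll q (A ∩ Sends m false) B
  solves-aliceᶠ s α β (a , e) b with s α β a b
  ... | v rewrite e = v

  solves-bobᵗ : SolvesAll (bob m p q) A B → SolvesAll p A (B ∩ Sends m true)
  solves-bobᵗ s α β a (b , e) with s α β a b
  ... | v rewrite e = v

  solves-bobᶠ : SolvesAll (bob m p q) A B → SolvesAll q A (B ∩ Sends m false)
  solves-bobᶠ s α β a (b , e) with s α β a b
  ... | v rewrite e = v

module _ {A B : Pred (Vec Three n) 0ℓ} (m : Vec Three n → Bool) {p q : KWProtocol n} where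

  -- Alice's bit splits `A`, and on each part the matching child is `𝟏`; on `B` both children are
  -- `𝟎`. The input pair is taken from a child of maximal depth, and the bit sent on it pays for the
  -- new gate.
  extracted-or : Extracted p (A ∩ Sends m true) B → Extracted q (A ∩ Sends m false) B →
                 Extracted (alice m p q) A B
  extracted-or E₁ E₀ = result (ℕ.⊔-sel (depth F) (depth G))
    where
    F = formula E₁
    G = formula E₀

    separates′ : Separates (F or G) A B
    separates′ with separates E₁ | separates E₀
    ... | F-𝟏 , F-𝟎 | G-𝟏 , G-𝟎 = or-𝟏 , λ β b → cong₂ _∨₃_ (F-𝟎 β b) (G-𝟎 β b)
      where
      or-𝟏 : ∀ α → α ∈ A → eval (F or G) α ≡ 𝟏
      or-𝟏 α a with m α in mα
      ... | true  = cong (_∨₃ _) (F-𝟏 α (a , mα))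
      ... | false = trans (cong (_ ∨₃_) (G-𝟏 α (a , mα))) (∨₃-zeroʳ _)

    result : depth F ⊔ depth G ≡ depth F ⊎ depth F ⊔ depth G ≡ depth G →
             Extracted (alice m p q) A B
    result (inj₁ ⊔≡F) with α∈A E₁
    ... | a , mα = record
      { formula = F or G ; separates = separates′ ; size≤ = ℕ.+-mono-≤ (size≤ E₁) (size≤ E₀)
      ; α∈A = a ; β∈B = β∈B E₁ ; depth≤ = bound }
      where
      bound : depth (F or G) ≤ bits (alice m p q) (α E₁) (β E₁)
      bound rewrite mα | ⊔≡F = s≤s (depth≤ E₁)
    result (inj₂ ⊔≡G) with α∈A E₀
    ... | a , mα = record
      { formula = F or G ; separates = separates′ ; size≤ = ℕ.+-mono-≤ (size≤ E₁) (size≤ E₀)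
      ; α∈A = a ; β∈B = β∈B E₀ ; depth≤ = bound }
      where
      bound : depth (F or G) ≤ bits (alice m p q) (α E₀) (β E₀)
      bound rewrite mα | ⊔≡G = s≤s (depth≤ E₀)

  extracted-and : Extracted p A (B ∩ Sends m true) → Extracted q A (B ∩ Sends m false) →
                  Extracted (bob m p q) A B
  extracted-and E₁ E₀ = result (ℕ.⊔-sel (depth F) (depth G))
    where
    F = formula E₁
    G = formula E₀

    separates′ : Separates (F and G) A B
    separates′ with separates E₁ | separates E₀
    ... | F-𝟏 , F-𝟎 | G-𝟏 , G-𝟎 = (λ α a → cong₂ _∧₃_ (F-𝟏 α a) (G-𝟏 α a)) , and-𝟎
      where
      and-𝟎 : ∀ β → β ∈ B → eval (F and G) β ≡ 𝟎
      and-𝟎 β b with m β in mβ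
      ... | true  = cong (_∧₃ _) (F-𝟎 β (b , mβ))
      ... | false = trans (cong (_ ∧₃_) (G-𝟎 β (b , mβ))) (∧₃-zeroʳ _)

    result : depth F ⊔ depth G ≡ depth F ⊎ depth F ⊔ depth G ≡ depth G →
             Extracted (bob m p q) A B
    result (inj₁ ⊔≡F) with β∈B E₁
    ... | b , mβ = record
      { formula = F and G ; separates = separates′ ; size≤ = ℕ.+-mono-≤ (size≤ E₁) (size≤ E₀)
      ; α∈A = α∈A E₁ ; β∈B = b ; depth≤ = bound }
      where
      bound : depth (F and G) ≤ bits (bob m p q) (α E₁) (β E₁)
      bound rewrite mβ | ⊔≡F = s≤s (depth≤ E₁)
    result (inj₂ ⊔≡G) with β∈B E₀
    ... | b , mβ = record
      { formula = F and G ; separates = separates′ ; size≤ = ℕ.+-mono-≤ (size≤ E₁) (size≤ E₀)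
      ; α∈A = α∈A E₀ ; β∈B = b ; depth≤ = bound }
      where
      bound : depth (F and G) ≤ bits (bob m p q) (α E₀) (β E₀)
      bound rewrite mβ | ⊔≡G = s≤s (depth≤ E₀)

  -- A message constant on `A` carries no information: the formula of the surviving branch separates
  -- the whole rectangle, and the extra bit and leaves only relax the bounds.
  extracted-aliceᵗ : (∀ α → α ∈ A → m α ≡ true) →
                     Extracted p (A ∩ Sends m true) B → Extracted (alice m p q) A B
  extracted-aliceᵗ always E with α∈A E | separates E
  ... | a , mα | F-𝟏 , F-𝟎 = record
    { formula = formula E ; separates = (λ α a → F-𝟏 α (a , always α a)) , F-𝟎
    ; size≤ = ℕ.m≤n⇒m≤n+o _ (size≤ E) ; α∈A = a ; β∈B = β∈B E ; depth≤ = bound }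
    where
    bound : depth (formula E) ≤ bits (alice m p q) (α E) (β E)
    bound rewrite mα = ℕ.m≤n⇒m≤1+n (depth≤ E)

  extracted-aliceᶠ : (∀ α → α ∈ A → m α ≡ false) →
                     Extracted q (A ∩ Sends m false) B → Extracted (alice m p q) A B
  extracted-aliceᶠ always E with α∈A E | separates E
  ... | a , mα | F-𝟏 , F-𝟎 = record
    { formula = formula E ; separates = (λ α a → F-𝟏 α (a , always α a)) , F-𝟎
    ; size≤ = ℕ.m≤n⇒m≤o+n _ (size≤ E) ; α∈A = a ; β∈B = β∈B E ; depth≤ = bound }
    where
    bound : depth (formula E) ≤ bits (alice m p q) (α E) (β E)
    bound rewrite mα = ℕ.m≤n⇒m≤1+n (depth≤ E)

  extracted-bobᵗ : (∀ β → β ∈ B → m β ≡ true) →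
                   Extracted p A (B ∩ Sends m true) → Extracted (bob m p q) A B
  extracted-bobᵗ always E with β∈B E | separates E
  ... | b , mβ | F-𝟏 , F-𝟎 = record
    { formula = formula E ; separates = F-𝟏 , λ β b → F-𝟎 β (b , always β b)
    ; size≤ = ℕ.m≤n⇒m≤n+o _ (size≤ E) ; α∈A = α∈A E ; β∈B = b ; depth≤ = bound }
    where
    bound : depth (formula E) ≤ bits (bob m p q) (α E) (β E)
    bound rewrite mβ = ℕ.m≤n⇒m≤1+n (depth≤ E)

  extracted-bobᶠ : (∀ β → β ∈ B → m β ≡ false) →
                   Extracted q A (B ∩ Sends m false) → Extracted (bob m p q) A B
  extracted-bobᶠ always E with β∈B E | separates E
  ... | b , mβ | F-𝟏 , F-𝟎 = record
    { formula = formula E ; separates = F-𝟏 , λ β b → F-𝟎 β (b , always β b)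
    ; size≤ = ℕ.m≤n⇒m≤o+n _ (size≤ E) ; α∈A = α∈A E ; β∈B = b ; depth≤ = bound }
    where
    bound : depth (formula E) ≤ bits (bob m p q) (α E) (β E)
    bound rewrite mβ = ℕ.m≤n⇒m≤1+n (depth≤ E)

always-false : {X : Set} {C : Pred X 0ℓ} (m : X → Bool) → ¬ ∃ (C ∩ Sends m true) →
               ∀ x → x ∈ C → m x ≡ false
always-false m ∄ x c = Bool.¬-not λ mx → ∄ (x , c , mx)

always-true : {X : Set} {C : Pred X 0ℓ} (m : X → Bool) → ¬ ∃ (C ∩ Sends m false) →
              ∀ x → x ∈ C → m x ≡ true
always-true m ∄ x c = Bool.¬-not λ mx → ∄ (x , c , mx)

valid-𝟏⇒𝟎 : ∀ (α β : Vec Three n) {i} → ValidAnswer α β i → lookup α i ≡ 𝟏 → lookup β i ≡ 𝟎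
valid-𝟏⇒𝟎 α β {i} (α≢β , _ , β≢𝐮) α≡𝟏 with lookup β i
... | 𝟎 = refl
... | 𝐮 = contradiction refl β≢𝐮
... | 𝟏 = contradiction α≡𝟏 α≢β

valid-𝟎⇒𝟏 : ∀ (α β : Vec Three n) {i} → ValidAnswer α β i → lookup α i ≡ 𝟎 → lookup β i ≡ 𝟏
valid-𝟎⇒𝟏 α β {i} (α≢β , _ , β≢𝐮) α≡𝟎 with lookup β i
... | 𝟎 = contradiction α≡𝟎 α≢β
... | 𝐮 = contradiction refl β≢𝐮
... | 𝟏 = refl

valid-sym : ∀ (α β : Vec Three n) {i} → ValidAnswer α β i → ValidAnswer β α i
valid-sym _ _ (α≢β , α≢𝐮 , β≢𝐮) = α≢β ∘ sym , β≢𝐮 , α≢𝐮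

-- Comparing every `β` with the fixed `α₀`, and every `α` with the fixed `β₀`, makes coordinate `i`
-- constant on `B` and on `A`, with opposite stable values. The value at `α₀` decides the sign of
-- the literal.
extract-leaf : {A B : Pred (Vec Three n) 0ℓ} (i : Fin n) → SolvesAll (leaf i) A B →
               ∀ α β → α ∈ A → β ∈ B → Extracted (leaf i) A B
extract-leaf {A = A} {B} i s α₀ β₀ a₀ b₀ with lookup α₀ i in α₀ᵢ
... | 𝐮 = contradiction α₀ᵢ (proj₁ (proj₂ (s α₀ β₀ a₀ b₀)))
... | 𝟏 = record
  { formula = pos i
  ; separates = (λ α a → valid-𝟎⇒𝟏 β₀ α (valid-sym α β₀ (s α β₀ a b₀)) β₀ᵢ)
              , λ β b → valid-𝟏⇒𝟎 α₀ β (s α₀ β a₀ b) α₀ᵢ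
  ; size≤ = ℕ.≤-refl ; α∈A = a₀ ; β∈B = b₀ ; depth≤ = z≤n }
  where β₀ᵢ = valid-𝟏⇒𝟎 α₀ β₀ (s α₀ β₀ a₀ b₀) α₀ᵢ
... | 𝟎 = record
  { formula = neg i
  ; separates = (λ α a → cong ¬₃_ (valid-𝟏⇒𝟎 β₀ α (valid-sym α β₀ (s α β₀ a b₀)) β₀ᵢ))
              , λ β b → cong ¬₃_ (valid-𝟎⇒𝟏 α₀ β (s α₀ β a₀ b) α₀ᵢ)
  ; size≤ = ℕ.≤-refl ; α∈A = a₀ ; β∈B = b₀ ; depth≤ = z≤n }
  where β₀ᵢ = valid-𝟎⇒𝟏 α₀ β₀ (s α₀ β₀ a₀ b₀) α₀ᵢ

-- Induction on the protocol. Decidability of `A` and `B` tells which parts of a split are empty, so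
-- that every leaf is reached with a pair to compare against.
extract : {A B : Pred (Vec Three n) 0ℓ} → Decidable A → Decidable B →
          (p : KWProtocol n) → SolvesAll p A B → ∃ A → ∃ B → Extracted p A B
extract A? B? (leaf i) s (α , a) (β , b) = extract-leaf i s α β a b
extract A? B? (alice m p q) s (α , a) B≠∅
  with anyVec₃? (A? ∩? sends? m true) | anyVec₃? (A? ∩? sends? m false)
-- As the part sending `true` is empty, the given `α` inhabits the other one.
... | no A₁=∅ | _ = extracted-aliceᶠ m never (extract (A? ∩? sends? m false) B? q
        (solves-aliceᶠ m p q s) (α , a , never α a) B≠∅)
  where never = always-false m A₁=∅
... | yes _ | no A₀=∅ = extracted-aliceᵗ m always (extract (A? ∩? sends? m true) B? p
        (solves-aliceᵗ m p q s) (α , a , always α a) B≠∅)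
  where always = always-true m A₀=∅
... | yes A₁≠∅ | yes A₀≠∅ = extracted-or m
        (extract (A? ∩? sends? m true) B? p (solves-aliceᵗ m p q s) A₁≠∅ B≠∅)
        (extract (A? ∩? sends? m false) B? q (solves-aliceᶠ m p q s) A₀≠∅ B≠∅)
extract A? B? (bob m p q) s A≠∅ (β , b)
  with anyVec₃? (B? ∩? sends? m true) | anyVec₃? (B? ∩? sends? m false)
... | no B₁=∅ | _ = extracted-bobᶠ m never (extract A? (B? ∩? sends? m false) q
        (solves-bobᶠ m p q s) A≠∅ (β , b , never β b))
  where never = always-false m B₁=∅
... | yes _ | no B₀=∅ = extracted-bobᵗ m always (extract A? (B? ∩? sends? m true) p
        (solves-bobᵗ m p q s) A≠∅ (β , b , always β b))
  where always = always-true m B₀=∅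
... | yes B₁≠∅ | yes B₀≠∅ = extracted-and m
        (extract A? (B? ∩? sends? m true) p (solves-bobᵗ m p q s) A≠∅ B₁≠∅)
        (extract A? (B? ∩? sends? m false) q (solves-bobᶠ m p q s) A≠∅ B₀≠∅)

-- Solvability of the game

-- Each index is tested for the values `𝟏`, `𝟎` and then `𝟎`, `𝟏`. The default `j` is answered only
-- after all tests fail. Efficiency is irrelevant, since only solvability is at stake.
search : Fin n → List (Fin n) → KWProtocol n
search j []       = leaf j
search j (i ∷ is) =
  alice (λ α → does (lookup α i ≟ 𝟏))
        (bob (λ β → does (lookup β i ≟ 𝟎)) (leaf i) (search j is))
        (alice (λ α → does (lookup α i ≟ 𝟎))
               (bob (λ β → does (lookup β i ≟ 𝟏)) (leaf i) (search j is))
               (search j is))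

-- The search stops at the head exactly when the head is valid; in all other cases the valid index
-- lies in the tail.
search-correct : ∀ (j : Fin n) is α β → Any (ValidAnswer α β) is →
                 ValidAnswer α β (answer (search j is) α β)
search-correct j (i ∷ is) α β v
  with lookup α i in αᵢ | lookup β i in βᵢ
... | 𝟏 | 𝟎 = differ where
  differ : ValidAnswer α β i
  differ rewrite αᵢ | βᵢ = (λ ()) , (λ ()) , λ ()
... | 𝟎 | 𝟏 = differ where
  differ : ValidAnswer α β i
  differ rewrite αᵢ | βᵢ = (λ ()) , (λ ()) , λ ()
search-correct j (i ∷ is) α β (here (α≢β , _ , _)) | 𝟎 | 𝟎 = contradiction (trans αᵢ (sym βᵢ)) α≢β
search-correct j (i ∷ is) α β (here (α≢β , _ , _)) | 𝟏 | 𝟏 = contradiction (trans αᵢ (sym βᵢ)) α≢β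
search-correct j (i ∷ is) α β (here (_ , α≢𝐮 , _)) | 𝐮 | _ = contradiction αᵢ α≢𝐮
search-correct j (i ∷ is) α β (here (_ , _ , β≢𝐮)) | 𝟎 | 𝐮 = contradiction βᵢ β≢𝐮
search-correct j (i ∷ is) α β (here (_ , _ , β≢𝐮)) | 𝟏 | 𝐮 = contradiction βᵢ β≢𝐮
search-correct j (i ∷ is) α β (there v) | 𝟎 | 𝟎 = search-correct j is α β v
search-correct j (i ∷ is) α β (there v) | 𝟎 | 𝐮 = search-correct j is α β v
search-correct j (i ∷ is) α β (there v) | 𝐮 | _ = search-correct j is α β v
search-correct j (i ∷ is) α β (there v) | 𝟏 | 𝐮 = search-correct j is α β v
search-correct j (i ∷ is) α β (there v) | 𝟏 | 𝟏 = search-correct j is α β v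

validAnswer? : (α β : Vec Three n) → Decidable (ValidAnswer α β)
validAnswer? α β i =
  ¬? (lookup α i ≟ lookup β i) ×-dec ¬? (lookup α i ≟ 𝐮) ×-dec ¬? (lookup β i ≟ 𝐮)

-- A stable first value wins, otherwise the second is copied; two `𝐮` give the arbitrary choice
-- `false`.
commonBit : Three → Three → Bool
commonBit 𝟎 _ = false
commonBit 𝟏 _ = true
commonBit 𝐮 y = does (y ≟ 𝟏)

commonBit-resolvesˡ : ∀ x y → x ≢ 𝐮 → fromBool (commonBit x y) ≡ x
commonBit-resolvesˡ 𝟎 _ _   = refl
commonBit-resolvesˡ 𝐮 _ x≢𝐮 = contradiction refl x≢𝐮
commonBit-resolvesˡ 𝟏 _ _   = refl

-- Since the first value wins, the second is respected only if the two are not opposite stable bits.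
commonBit-resolvesʳ : ∀ x y → ¬ (x ≢ y × x ≢ 𝐮 × y ≢ 𝐮) → y ≢ 𝐮 →
                      fromBool (commonBit x y) ≡ y
commonBit-resolvesʳ _ 𝐮 _ y≢𝐮 = contradiction refl y≢𝐮
commonBit-resolvesʳ 𝟎 𝟎 _ _   = refl
commonBit-resolvesʳ 𝐮 𝟎 _ _   = refl
commonBit-resolvesʳ 𝟏 𝟎 ¬v _  = contradiction ((λ ()) , (λ ()) , λ ()) ¬v
commonBit-resolvesʳ 𝟎 𝟏 ¬v _  = contradiction ((λ ()) , (λ ()) , λ ()) ¬v
commonBit-resolvesʳ 𝐮 𝟏 _ _   = refl
commonBit-resolvesʳ 𝟏 𝟏 _ _   = refl

commonResolution : (α β : Vec Three n) → ¬ ∃ (ValidAnswer α β) →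
                   ∃[ a ] a IsResolutionOf α × a IsResolutionOf β
commonResolution α β ∄valid = tabulate bit , resolves-α , resolves-β
  where
  bit = λ i → commonBit (lookup α i) (lookup β i)

  resolves-α : tabulate bit IsResolutionOf α
  resolves-α i α≢𝐮 = trans (cong fromBool (lookup∘tabulate bit i))
                           (commonBit-resolvesˡ _ _ α≢𝐮)

  resolves-β : tabulate bit IsResolutionOf β
  resolves-β i β≢𝐮 = trans (cong fromBool (lookup∘tabulate bit i))
                           (commonBit-resolvesʳ _ _ (λ v → ∄valid (i , v)) β≢𝐮)

hazardFreeExt-𝟏 : (f : Vec Bool n → Bool) → ∀ {α} → hazardFreeExt f α ≡ 𝟏 →
                  ConstantOnResolutions f α true
hazardFreeExt-𝟏 f {α} e
  with constantOnResolutions? f α true | constantOnResolutions? f α false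
... | yes constant | _     = constant
... | no _         | yes _ = contradiction e λ ()
... | no _         | no _  = contradiction e λ ()

hazardFreeExt-𝟎 : (f : Vec Bool n → Bool) → ∀ {α} → hazardFreeExt f α ≡ 𝟎 →
                  ConstantOnResolutions f α false
hazardFreeExt-𝟎 f {α} e
  with constantOnResolutions? f α true | constantOnResolutions? f α false
... | yes _ | _            = contradiction e λ ()
... | no _  | yes constant = constant
... | no _  | no _         = contradiction e λ ()

-- A search through the finitely many indices turns the refutation of "no valid answer" into an
-- index.
∃validAnswer : (f : Vec Bool n → Bool) → ∀ {α β} →
               hazardFreeExt f α ≡ 𝟏 → hazardFreeExt f β ≡ 𝟎 → ∃ (ValidAnswer α β)
∃validAnswer f {α} {β} fα≡𝟏 fβ≡𝟎 = decidable-stable (Fin.any? (validAnswer? α β)) λ ∄valid →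
  let a , a-resolves-α , a-resolves-β = commonResolution α β ∄valid
      fa≡true  = hazardFreeExt-𝟏 f fα≡𝟏 a a-resolves-α
      fa≡false = hazardFreeExt-𝟎 f fβ≡𝟎 a a-resolves-β
  in contradiction (trans (sym fa≡true) fa≡false) λ ()

-- The game of a nonconstant function

module HazardFreeGame
  (f : Vec Bool n → Bool) (∃true : ∃[ a ] f a ≡ true) (∃false : ∃[ b ] f b ≡ false)
  (A B : Pred (Vec Three n) 0ℓ) (A? : Decidable A) (B? : Decidable B)
  (true⊆A : ∀ a → f a ≡ true → embed a ∈ A)
  (A⊆𝟏 : ∀ α → α ∈ A → hazardFreeExt f α ≡ 𝟏)
  (false⊆B : ∀ b → f b ≡ false → embed b ∈ B)
  (B⊆𝟎 : ∀ β → β ∈ B → hazardFreeExt f β ≡ 𝟎) where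

  A≠∅ : ∃ A
  A≠∅ = let a , fa = ∃true in embed a , true⊆A a fa

  B≠∅ : ∃ B
  B≠∅ = let b , fb = ∃false in embed b , false⊆B b fb

  separates⇒computes : ∀ F → Separates F A B → Computes F f
  separates⇒computes F (F-𝟏 , F-𝟎) a with f a in fa
  ... | true  = F-𝟏 (embed a) (true⊆A a fa)
  ... | false = F-𝟎 (embed a) (false⊆B a fa)

  separates⇒hazardFree : ∀ F → Separates F A B → HazardFreeOn F f (A ∪ B)
  separates⇒hazardFree F (F-𝟏 , F-𝟎) γ (inj₁ a) = trans (F-𝟏 γ a) (sym (A⊆𝟏 γ a))
  separates⇒hazardFree F (F-𝟏 , F-𝟎) γ (inj₂ b) = trans (F-𝟎 γ b) (sym (B⊆𝟎 γ b))

  -- The values of the hazard-free extension on `A` and `B` are known. Together with the two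
  -- converses above, the formulas to be minimized over are exactly the separating ones.
  hazardFree⇒separates : ∀ F → HazardFreeOn F f (A ∪ B) → Separates F A B
  hazardFree⇒separates F F-hf =
    (λ α a → trans (F-hf α (inj₁ a)) (A⊆𝟏 α a)) , λ β b → trans (F-hf β (inj₂ b)) (B⊆𝟎 β b)

  protocol⇒extracted : (p : KWProtocol n) → Solves p A B → Extracted p A B
  protocol⇒extracted p p-solves =
    extract A? B? p (λ α β → p-solves {α} {β}) A≠∅ B≠∅

  ∃separating : ∃[ F ] Separates F A B
  ∃separating = formula E , separates E
    where
    -- The default for `search` is a valid answer for some pair of the nonempty rectangle.
    anyIndex : Fin n
    anyIndex = let α , a = A≠∅ ; β , b = B≠∅ in proj₁ (∃validAnswer f (A⊆𝟏 α a) (B⊆𝟎 β b))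

    E : Extracted (search anyIndex (allFin n)) A B
    E = protocol⇒extracted _ λ {α} {β} a b →
      let i , valid = ∃validAnswer f (A⊆𝟏 α a) (B⊆𝟎 β b)
      in search-correct anyIndex (allFin n) α β (lose (∈-allFin i) valid)

  Achieved : (Formula n → ℕ) → Pred ℕ 0ℓ
  Achieved μ k = ∃[ F ] Computes F f × HazardFreeOn F f (A ∪ B) × μ F ≡ k

  achieved : ∀ μ F → Separates F A B → Achieved μ (μ F)
  achieved μ F F-sep =
    F , separates⇒computes F F-sep , separates⇒hazardFree F F-sep , refl

  -- If `μ F` is `k`, then `F` has depth at most `k`, so the search up to depth `k` misses no
  -- candidate.
  achieved? : ∀ μ → (∀ F → depth F ≤ μ F) → Decidable (Achieved μ)
  achieved? μ depth≤μ k =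
    map′ (λ { (F , _ , F-sep , refl) → achieved μ F F-sep })
         (λ { (F , _ , F-hf , refl) → F , depth≤μ F , hazardFree⇒separates F F-hf , refl })
         (anyOfDepth≤? (λ F → separates? A? B? F ×-dec (μ F ℕ.≟ k)) k)

  minimum : ∀ μ → (∀ F → depth F ≤ μ F) → ∃ (IsMinimum (Achieved μ))
  minimum μ depth≤μ =
    leastNumber (achieved? μ depth≤μ) _ (achieved μ (proj₁ ∃separating) (proj₂ ∃separating))

  solves-toProtocol : ∀ F → HazardFreeOn F f (A ∪ B) → Solves (toProtocol F) A B
  solves-toProtocol F F-hf {α} {β} a b =
    let F-𝟏 , F-𝟎 = hazardFree⇒separates F F-hf
    in answer-toProtocol F (F-𝟏 α a) (F-𝟎 β b)

  -- Every solving protocol has a pair in `A` and `B` on which it exchanges at least `d` bits, by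
  -- extraction and minimality of `d`. For `toProtocol F` this shows that `d` is attained; for any
  -- other protocol, that its cost is at least `d`.
  minimalDepth⇒cost : ∀ {d} → IsMinimalDepth f A B d → IsCommunicationCost A B d
  minimalDepth⇒cost {d} ((F , _ , F-hf , depth≡d) , d-least) =
    (p , p-solves , p-cost) , least
    where
    p = toProtocol F

    p-solves : Solves p A B
    p-solves {α} {β} = solves-toProtocol F F-hf {α} {β}

    bits≤d : ∀ α β → bits p α β ≤ d
    bits≤d α β = ℕ.≤-trans (bits-toProtocol F α β) (ℕ.≤-reflexive depth≡d)

    d≤bits : ∀ {q} (E : Extracted q A B) → d ≤ bits q (α E) (β E)
    d≤bits E = ℕ.≤-trans (d-least _ (achieved depth (formula E) (separates E))) (depth≤ E)

    p-cost : IsCost A B p d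
    p-cost = (α E , β E , α∈A E , β∈B E , ℕ.≤-antisym (bits≤d _ _) (d≤bits E)) ,
             λ { _ (α , β , _ , _ , refl) → bits≤d α β }
      where E = protocol⇒extracted p λ {α} {β} → p-solves {α} {β}

    least : ∀ c → (∃[ q ] Solves q A B × IsCost A B q c) → d ≤ c
    least c (q , q-solves , _ , q-max) =
      ℕ.≤-trans (d≤bits E) (q-max _ (α E , β E , α∈A E , β∈B E , refl))
      where E = protocol⇒extracted q λ {α} {β} → q-solves {α} {β}

  -- `toProtocol` turns size into the number of leaves, and extraction never yields more leaves than
  -- the protocol has.
  minimalSize⇒leaves : ∀ {s} → IsMinimalSize f A B s → IsMinimalLeaves A B s
  minimalSize⇒leaves {s} ((F , _ , F-hf , size≡s) , s-least) =
    (toProtocol F , (λ {α} {β} → solves-toProtocol F F-hf {α} {β}) ,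
     trans (leaves-toProtocol F) size≡s) , least
    where
    least : ∀ l → (∃[ q ] Solves q A B × leaves q ≡ l) → s ≤ l
    least _ (q , q-solves , refl) =
      ℕ.≤-trans (s-least _ (achieved size (formula E) (separates E))) (size≤ E)
      where E = protocol⇒extracted q λ {α} {β} → q-solves {α} {β}

proposition8p1 : (n : ℕ) (f : Vec Bool n → Bool) →
    (∃[ a ] f a ≡ true) → (∃[ b ] f b ≡ false) →
    (A B : Pred (Vec Three n) 0ℓ) → Decidable A → Decidable B →
    (∀ a → f a ≡ true → embed a ∈ A) →
    (∀ α → α ∈ A → hazardFreeExt f α ≡ 𝟏) →
    (∀ b → f b ≡ false → embed b ∈ B) →
    (∀ β → β ∈ B → hazardFreeExt f β ≡ 𝟎) →
    (∃[ d ] (IsMinimalDepth f A B d × IsCommunicationCost A B d)) ×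
    (∃[ s ] (IsMinimalSize f A B s × IsMinimalLeaves A B s))
proposition8p1 n f ∃true ∃false A B A? B? true⊆A A⊆𝟏 false⊆B B⊆𝟎 =
  (let d , d-min = minimum depth (λ _ → ℕ.≤-refl) in d , d-min , minimalDepth⇒cost d-min) ,
  (let s , s-min = minimum size (λ F → ℕ.<⇒≤ (depth<size F)) in
   s , s-min , minimalSize⇒leaves s-min)
  where open HazardFreeGame f ∃true ∃false A B A? B? true⊆A A⊆𝟏 false⊆B B⊆𝟎
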